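{- Let $\varepsilon>0$ be any constant. No (possibly randomized) online algorithm for the cardinality model is $(1/2+\varepsilon)$-competitive. Moreover, even if the objective function is restricted to be monotone, no randomized online algorithm for the cardinality model is $(3/4+\varepsilon)$-competitive, and no deterministic online algorithm for the cardinality model is $(1/2+\varepsilon)$-competitive.
   Context: The cardinality model: there is an unknown finite ground set $\mathcal N=\{u_1,\dots,u_n\}$, a non-negative submodular function $f:2^{\mathcal N}\to\mathbb R_{\ge0}$ (not necessarily monotone), and a parameter $0\le k\le n$ known to the algorithm. A set $S\subseteq\mathcal N$ is feasible if and only if $|S|\le k$. The elements are revealed one by one in the order $u_1,\dots,u_n$, chosen by an adversary. The algorithm does not know $n$ in advance. It maintains feasible solutions $S_0=\varnothing,S_1,\dots,S_n$, where immediately after $u_i$ is revealed it chooses $S_i$ to be any feasible subset of $S_{i-1}\cup\{u_i\}$. The choice may depend only on the values of $f$ on subsets of $\{u_1,\dots,u_i\}$ (accessed through a value oracle), the past, and, for randomized algorithms, internal randomness; elements carry no information other than their arrival position and these values. The computational power of the algorithm is not restricted. The algorithm is $\alpha$-competitive if $\mathbb E[f(S_n)]\ge\alpha\cdot\max\{f(S): S\subseteq\mathcal N,\ |S|\le k\}$ for every instance (every $\mathcal N$, $f$, $k$ and revelation order). The instance is fixed independently of the outcome of the algorithm's random choices, but may depend on the algorithm. $f$ is monotone if $A\subseteq B\subseteq \mathcal N$ implies $f(A)\le f(B)$. -}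

module Defs where

open import Algebra.Apartness.Bundles using (HeytingField; HeytingCommutativeRing)
open import Algebra.Bundles using (CommutativeRing)
import Algebra.Definitions.RawMonoid as Multiple
open import Algebra.Properties.Group using (ε⁻¹≈ε)
open import Data.Bool.Base using (Bool; true; false; not; _∧_; _∨_)
open import Data.Fin.Subset
  using (Subset; inside; outside; _⊆_; _∪_; _∩_; ∣_∣)
open import Data.Nat.Base as ℕ using (ℕ; zero; suc; NonZero)
open import Data.Product.Base using (∃-syntax; _×_; _,_; proj₁; proj₂)
open import Data.Sum.Base using (_⊎_; inj₂)
open import Data.Vec.Base using ([]; _∷_)
open import Function.Bundles using (_⇔_; Equivalence)
open import Level using (Level; _⊔_) renaming (suc to lsuc)
open import Relation.Binary.Core using (Rel)
open import Relation.Binary.PropositionalEquality.Core using (_≡_)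
import Relation.Binary.Reasoning.Setoid as ≈-Reasoning
open import Relation.Binary.Structures using (IsStrictPartialOrder)
open import Relation.Nullary.Negation.Core using (¬_)

-- The standard library has no real numbers, so they are given by their
-- axioms: a Cauchy complete Archimedean ordered field.  Classically ℝ is the
-- only model up to isomorphism.  The axioms are phrased without decidability
-- of the order, so that they also hold for the constructive Cauchy reals.
record RealNumbers c ℓ₁ ℓ₂ : Set (lsuc (c ⊔ ℓ₁ ⊔ ℓ₂)) where
  field
    heytingField : HeytingField c ℓ₁ ℓ₂

  open HeytingField heytingField public
    renaming (Carrier to ℝ) hiding (zero)
  open HeytingCommutativeRing heytingCommutativeRing public
    using (commutativeRing)

  infix 4 _<_ _≤_

  field
    _<_                  : Rel ℝ ℓ₂
    isStrictPartialOrder : IsStrictPartialOrder _≈_ _<_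
    #⇔<⊎>                : ∀ {x y} → (x # y) ⇔ (x < y ⊎ y < x)
    +-monoˡ-<            : ∀ {x y} z → x < y → x + z < y + z
    *-pos                : ∀ {x y} → 0# < x → 0# < y → 0# < x * y
    0<1                  : 0# < 1#

  open IsStrictPartialOrder isStrictPartialOrder public
    using (<-respˡ-≈; <-respʳ-≈)
    renaming (trans to <-trans; irrefl to <-irrefl)

  _≤_ : Rel ℝ ℓ₂
  x ≤ y = ¬ (y < x)

  fromℕ : ℕ → ℝ
  fromℕ n = Multiple._×_ (CommutativeRing.+-rawMonoid commutativeRing) n 1#

  Within : ℝ → ℝ → ℝ → Set ℓ₂
  Within δ x y = (x - y < δ) × (y - x < δ)

  IsCauchy : (ℕ → ℝ) → Set (c ⊔ ℓ₂)
  IsCauchy s = ∀ δ → 0# < δ →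
    ∃[ N ] (∀ m n → N ℕ.≤ m → N ℕ.≤ n → Within δ (s m) (s n))

  ConvergesTo : (ℕ → ℝ) → ℝ → Set (c ⊔ ℓ₂)
  ConvergesTo s l = ∀ δ → 0# < δ →
    ∃[ N ] (∀ n → N ℕ.≤ n → Within δ (s n) l)

  field
    archimedean : ∀ x → ∃[ n ] x < fromℕ n
    complete    : ∀ s → IsCauchy s → ∃[ l ] ConvergesTo s l

  0<fromℕ : ∀ n → 0# < fromℕ (suc n)
  0<fromℕ zero    = <-respʳ-≈ (sym (+-identityʳ 1#)) 0<1
  0<fromℕ (suc n) =
    <-trans (0<fromℕ n)
      (<-respˡ-≈ (+-identityˡ (fromℕ (suc n))) (+-monoˡ-< (fromℕ (suc n)) 0<1))

  fromℕ#0 : ∀ n .{{_ : NonZero n}} → fromℕ n # 0#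
  fromℕ#0 (suc n) = Equivalence.from #⇔<⊎> (inj₂ (0<fromℕ n))

  infixl 7 _/_

  -- `#⇒invertible` inverts the difference `fromℕ n - 0#`.
  _/_ : ℕ → (n : ℕ) → .{{NonZero n}} → ℝ
  m / n = fromℕ m * proj₁ (#⇒invertible (fromℕ#0 n))

  /-inverse : ∀ m n .{{_ : NonZero n}} → m / n * fromℕ n ≈ fromℕ m
  /-inverse m n = begin
    m / n * fromℕ n                  ≈⟨ *-assoc (fromℕ m) n⁻¹ (fromℕ n) ⟩
    fromℕ m * (n⁻¹ * fromℕ n)        ≈⟨ *-congˡ (*-congˡ x-0≈x) ⟨
    fromℕ m * (n⁻¹ * (fromℕ n - 0#)) ≈⟨ *-congˡ inverseˡ ⟩
    fromℕ m * 1#                     ≈⟨ *-identityʳ (fromℕ m) ⟩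
    fromℕ m                          ∎
    where
    open ≈-Reasoning (CommutativeRing.setoid commutativeRing)
    n⁻¹ = proj₁ (#⇒invertible (fromℕ#0 n))
    inverseˡ : n⁻¹ * (fromℕ n - 0#) ≈ 1#
    inverseˡ = proj₁ (proj₂ (#⇒invertible (fromℕ#0 n)))
    x-0≈x : fromℕ n - 0# ≈ fromℕ n
    x-0≈x = trans (+-congˡ (ε⁻¹≈ε (CommutativeRing.+-group commutativeRing)))
                  (+-identityʳ (fromℕ n))

module CardinalityModel {c ℓ₁ ℓ₂} (R : RealNumbers c ℓ₁ ℓ₂) where

  open RealNumbers R public

  -- Elements carry no information besides their arrival position, so the
  -- ground set u₁ , … , uₙ is given by positions.  The latest element comes
  -- first: index 0 is uₙ and index n - 1 is u₁.  Hence, for S ⊆ {u₁ , … , uᵢ},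
  -- `outside ∷ S` is S regarded as a subset of {u₁ , … , uᵢ₊₁}, and
  -- `inside ∷ S` is S ∪ {uᵢ₊₁}.
  SetFunction : ℕ → Set c
  SetFunction n = Subset n → ℝ

  NonNegative : ∀ {n} → SetFunction n → Set ℓ₂
  NonNegative f = ∀ S → 0# ≤ f S

  Submodular : ∀ {n} → SetFunction n → Set ℓ₂
  Submodular f = ∀ S T → f (S ∪ T) + f (S ∩ T) ≤ f S + f T

  Monotone : ∀ {n} → SetFunction n → Set ℓ₂
  Monotone f = ∀ S T → S ⊆ T → f S ≤ f T

  Feasible : ∀ {n} → ℕ → Subset n → Set
  Feasible k S = ∣ S ∣ ℕ.≤ k

  IsOptimal : ∀ {n} → ℕ → SetFunction n → Subset n → Set ℓ₂
  IsOptimal k f S = Feasible k S × (∀ T → Feasible k T → f T ≤ f S)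

  beforeLast : ∀ {i} → SetFunction (suc i) → SetFunction i
  beforeLast f S = f (outside ∷ S)

  -- `solution k {i} f` is Sᵢ when f is the objective restricted to subsets of
  -- {u₁ , … , uᵢ}; the length of the whole input is not available.  The past
  -- solutions are themselves functions of k and f, so they are not arguments.
  record DeterministicAlgorithm : Set (c ⊔ ℓ₁) where
    field
      solution : ℕ → ∀ {i} → SetFunction i → Subset i
      feasible : ∀ k {i} (f : SetFunction i) → Feasible k (solution k f)
      online   : ∀ k {i} (f : SetFunction (suc i)) →
                 solution k f ⊆ inside ∷ solution k (beforeLast f)
      -- The choice depends on the values of f as real numbers, not on how
      -- these are represented.
      cong     : ∀ k {i} {f g : SetFunction i} → (∀ S → f S ≈ g S) →
                 solution k f ≡ solution k g

  -- An algebra of events with a probability.  Only finitely many events matter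
  -- for a given instance, so countable additivity is not demanded; every
  -- probability space in the usual sense is of this form.
  record ProbabilitySpace a e : Set (c ⊔ ℓ₁ ⊔ ℓ₂ ⊔ lsuc (a ⊔ e)) where
    infixr 6 _∪ᵉ_
    field
      Ω        : Set a
      Event    : Set e
      occurs   : Event → Ω → Bool
      certain  : Event
      ∁ᵉ       : Event → Event
      _∪ᵉ_     : Event → Event → Event
      occurs-certain : ∀ ω → occurs certain ω ≡ true
      occurs-∁       : ∀ A ω → occurs (∁ᵉ A) ω ≡ not (occurs A ω)
      occurs-∪       : ∀ A B ω → occurs (A ∪ᵉ B) ω ≡ occurs A ω ∨ occurs B ω
      ℙ          : Event → ℝ
      ℙ-cong     : ∀ A B → (∀ ω → occurs A ω ≡ occurs B ω) → ℙ A ≈ ℙ B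
      ℙ-nonNeg   : ∀ A → 0# ≤ ℙ A
      ℙ-certain  : ℙ certain ≈ 1#
      ℙ-additive : ∀ A B → (∀ ω → occurs A ω ∧ occurs B ω ≡ false) →
                   ℙ (A ∪ᵉ B) ≈ ℙ A + ℙ B

  -- The internal randomness ω is drawn once, independently of the instance;
  -- given ω the algorithm is deterministic.  The field `returns` says that
  -- the solution held on any fixed input is a random variable.
  record RandomizedAlgorithm a e : Set (c ⊔ ℓ₁ ⊔ ℓ₂ ⊔ lsuc (a ⊔ e)) where
    field
      probabilitySpace : ProbabilitySpace a e

    open ProbabilitySpace probabilitySpace public

    field
      run : Ω → DeterministicAlgorithm

    solution : Ω → ℕ → ∀ {i} → SetFunction i → Subset i
    solution ω = DeterministicAlgorithm.solution (run ω)

    field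
      returns        : ℕ → ∀ {i} → SetFunction i → Subset i → Event
      occurs-returns : ∀ k {i} (f : SetFunction i) S ω →
                       (occurs (returns k f S) ω ≡ true) ⇔ (solution ω k f ≡ S)

  sumOverSubsets : ∀ {n} → (Subset n → ℝ) → ℝ
  sumOverSubsets {zero}  g = g []
  sumOverSubsets {suc n} g =
    sumOverSubsets (λ S → g (outside ∷ S)) + sumOverSubsets (λ S → g (inside ∷ S))

  -- The (expected) value obtained with parameter k on the objective f.
  Performance : Set c
  Performance = ∀ {n} → ℕ → SetFunction n → ℝ

  achieved : DeterministicAlgorithm → Performance
  achieved D k f = f (DeterministicAlgorithm.solution D k f)

  expected : ∀ {a e} → RandomizedAlgorithm a e → Performance
  expected A k f = sumOverSubsets (λ S → ℙ (returns k f S) * f S)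
    where open RandomizedAlgorithm A

  Competitive : ℝ → Performance → Set (c ⊔ ℓ₂)
  Competitive α value =
    ∀ {n} k (f : SetFunction n) → k ℕ.≤ n → NonNegative f → Submodular f →
    ∀ S → IsOptimal k f S → α * f S ≤ value k f

  CompetitiveOnMonotone : ℝ → Performance → Set (c ⊔ ℓ₂)
  CompetitiveOnMonotone α value =
    ∀ {n} k (f : SetFunction n) → k ℕ.≤ n → NonNegative f → Submodular f →
    Monotone f → ∀ S → IsOptimal k f S → α * f S ≤ value k f

{-# OPTIONS --safe #-}
-- All elements but the last are interchangeable and worth 1 each, so the set Y
-- held before the last element w arrives cannot depend on a hidden set G.  Then
-- w is worth k, but spoils everything outside G: the optimum w ∪ (k - 1
-- elements of G) has value 2k - 1, while the algorithm gets at most k + |Y ∩ G|.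
-- If G ranges over q disjoint blocks of size k, the sum of |Y ∩ G| is at most k,
-- so the average value is at most k + k / q: about 1/2 of the optimum for q
-- large and 3/4 for q = 2.  The objective is monotone if at most k elements lie
-- outside G, which is the case for q = 2, and for G = ∁ Y with |Y| ≤ k, where a
-- deterministic algorithm gets only k.

module Submission where

open import Defs
open import Data.Nat.Base using (nonZero)
open import Data.Product.Base using (_×_)
open import Relation.Nullary.Negation.Core using (¬_)
open import Algebra.Bundles using (CommutativeMonoid; CommutativeRing)
open import Data.Bool.Base using (true; false; _∧_)
open import Data.Bool.Properties
  using (⇔→≡; ¬-not; not-involutive; ∧-idem; ∨-idem; ∨-zeroʳ; ∧-conicalˡ; ∧-conicalʳ)
open import Data.Empty using (⊥-elim)
open import Data.Fin.Subset using (Subset; inside; outside; _⊆_; _∪_; _∩_; ∁; ⊤; ⊥; ∣_∣)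
open import Data.Fin.Subset.Properties
open import Data.List.Base using (List; []; _∷_; length; map)
open import Data.List.Properties using (length-map; map-∘; map-cong)
open import Data.List.Relation.Unary.All as All using (All; []; _∷_)
import Data.List.Relation.Unary.All.Properties as All
open import Data.Nat.Base as ℕ using (ℕ; zero; suc; NonZero; z≤n; s≤s)
open import Data.Nat.ListAction using (sum)
import Data.Nat.Properties as ℕ
open import Data.Nat.Tactic.RingSolver using (solve-∀)
open import Data.Product.Base using (∃-syntax; _,_; proj₁; proj₂)
open import Data.Sum.Base using (inj₁; inj₂)
open import Data.Vec.Base using ([]; _∷_; _++_; splitAt; here)
open import Data.Vec.Properties using (zipWith-++; ∷-injectiveʳ)
open import Function.Base using (_∘_)
open import Function.Bundles using (_⇔_; mk⇔; Equivalence)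
open import Relation.Binary.PropositionalEquality as ≡ using (_≡_)
import Relation.Binary.Reasoning.Base.Triple as Triple
import Relation.Binary.Reasoning.Setoid as ≈-Reasoning
open import Relation.Binary.Structures using (IsPreorder; IsStrictPartialOrder)
open import Relation.Nullary.Decidable.Core using (yes; no)

-- Cardinalities of finite subsets.

-- Turns a polynomial inequality into an identity for the ring solver, with `n` as the explicit
-- difference.
m+n≡o⇒m≤o : ∀ {m n o} → m ℕ.+ n ≡ o → m ℕ.≤ o
m+n≡o⇒m≤o {m} {n} ≡.refl = ℕ.m≤m+n m n

∣p∪q∣+∣p∩q∣≡∣p∣+∣q∣ : ∀ {m} (p q : Subset m) → ∣ p ∪ q ∣ ℕ.+ ∣ p ∩ q ∣ ≡ ∣ p ∣ ℕ.+ ∣ q ∣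
∣p∪q∣+∣p∩q∣≡∣p∣+∣q∣ []            []            = ≡.refl
∣p∪q∣+∣p∩q∣≡∣p∣+∣q∣ (outside ∷ p) (outside ∷ q) = ∣p∪q∣+∣p∩q∣≡∣p∣+∣q∣ p q
∣p∪q∣+∣p∩q∣≡∣p∣+∣q∣ (inside  ∷ p) (outside ∷ q) = ≡.cong suc (∣p∪q∣+∣p∩q∣≡∣p∣+∣q∣ p q)
∣p∪q∣+∣p∩q∣≡∣p∣+∣q∣ (outside ∷ p) (inside  ∷ q) =
  ≡.trans (≡.cong suc (∣p∪q∣+∣p∩q∣≡∣p∣+∣q∣ p q)) (≡.sym (ℕ.+-suc ∣ p ∣ ∣ q ∣))
∣p∪q∣+∣p∩q∣≡∣p∣+∣q∣ (inside  ∷ p) (inside  ∷ q) = ≡.cong suc (begin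
  ∣ p ∪ q ∣ ℕ.+ suc ∣ p ∩ q ∣   ≡⟨ ℕ.+-suc ∣ p ∪ q ∣ ∣ p ∩ q ∣ ⟩
  suc (∣ p ∪ q ∣ ℕ.+ ∣ p ∩ q ∣) ≡⟨ ≡.cong suc (∣p∪q∣+∣p∩q∣≡∣p∣+∣q∣ p q) ⟩
  suc (∣ p ∣ ℕ.+ ∣ q ∣)         ≡⟨ ℕ.+-suc ∣ p ∣ ∣ q ∣ ⟨
  ∣ p ∣ ℕ.+ suc ∣ q ∣           ∎)
  where open ≡.≡-Reasoning

∣p∪q∣≤∣p∣+∣q∣ : ∀ {m} (p q : Subset m) → ∣ p ∪ q ∣ ℕ.≤ ∣ p ∣ ℕ.+ ∣ q ∣
∣p∪q∣≤∣p∣+∣q∣ p q = ℕ.≤-trans (ℕ.m≤m+n _ _) (ℕ.≤-reflexive (∣p∪q∣+∣p∩q∣≡∣p∣+∣q∣ p q))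

-- Cardinality is modular, so both sides can be rewritten through unions and intersections;
-- comparing these two is enough, even if neither `p` nor `q` lies inside `r` or `s`.
∣∣-weakMajorisation : ∀ {m} {p q r s : Subset m} → p ∪ q ⊆ r ∪ s → p ∩ q ⊆ r ∩ s →
                      ∣ p ∣ ℕ.+ ∣ q ∣ ℕ.≤ ∣ r ∣ ℕ.+ ∣ s ∣
∣∣-weakMajorisation {p = p} {q} {r} {s} ∪⊆ ∩⊆ = begin
  ∣ p ∣ ℕ.+ ∣ q ∣         ≡⟨ ∣p∪q∣+∣p∩q∣≡∣p∣+∣q∣ p q ⟨
  ∣ p ∪ q ∣ ℕ.+ ∣ p ∩ q ∣ ≤⟨ ℕ.+-mono-≤ (p⊆q⇒∣p∣≤∣q∣ ∪⊆) (p⊆q⇒∣p∣≤∣q∣ ∩⊆) ⟩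
  ∣ r ∪ s ∣ ℕ.+ ∣ r ∩ s ∣ ≡⟨ ∣p∪q∣+∣p∩q∣≡∣p∣+∣q∣ r s ⟩
  ∣ r ∣ ℕ.+ ∣ s ∣         ∎
  where open ℕ.≤-Reasoning

∩-monoˡ-⊆ : ∀ {m} {p q : Subset m} r → p ⊆ q → p ∩ r ⊆ q ∩ r
∩-monoˡ-⊆ {p = p} r p⊆q x∈p∩r with x∈p∩q⁻ p r x∈p∩r
... | x∈p , x∈r = x∈p∩q⁺ (p⊆q x∈p , x∈r)

∩-distribʳ-∩ : ∀ {m} (r p q : Subset m) → (p ∩ q) ∩ r ≡ (p ∩ r) ∩ (q ∩ r)
∩-distribʳ-∩ {m} r p q = ≡.trans (≡.cong ((p ∩ q) ∩_) (≡.sym (∩-idem r))) (interchange p q r r)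
  where
  open CommutativeMonoid (∩-commutativeMonoid m) using (commutativeSemigroup)
  open import Algebra.Properties.CommutativeSemigroup commutativeSemigroup using (interchange)

-- (p ∪ q) ∩ g and p ∩ q against p ∩ g and q: both their union and their
-- intersection shrink.
∣[p∪q]∩g∣+∣p∩q∣≤∣p∩g∣+∣q∣ : ∀ {m} (p q g : Subset m) →
  ∣ (p ∪ q) ∩ g ∣ ℕ.+ ∣ p ∩ q ∣ ℕ.≤ ∣ p ∩ g ∣ ℕ.+ ∣ q ∣
∣[p∪q]∩g∣+∣p∩q∣≤∣p∩g∣+∣q∣ p q g = ∣∣-weakMajorisation ∪⊆ ∩⊆
  where
  ∪⊆ : ((p ∪ q) ∩ g) ∪ (p ∩ q) ⊆ (p ∩ g) ∪ q
  ∪⊆ x∈ with x∈p∪q⁻ ((p ∪ q) ∩ g) (p ∩ q) x∈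
  ... | inj₂ x∈p∩q = x∈p∪q⁺ (inj₂ (proj₂ (x∈p∩q⁻ p q x∈p∩q)))
  ... | inj₁ x∈[p∪q]∩g with x∈p∩q⁻ (p ∪ q) g x∈[p∪q]∩g
  ...   | x∈p∪q , x∈g with x∈p∪q⁻ p q x∈p∪q
  ...     | inj₁ x∈p = x∈p∪q⁺ (inj₁ (x∈p∩q⁺ (x∈p , x∈g)))
  ...     | inj₂ x∈q = x∈p∪q⁺ (inj₂ x∈q)
  ∩⊆ : ((p ∪ q) ∩ g) ∩ (p ∩ q) ⊆ (p ∩ g) ∩ q
  ∩⊆ x∈ with x∈p∩q⁻ ((p ∪ q) ∩ g) (p ∩ q) x∈
  ... | x∈[p∪q]∩g , x∈p∩q with x∈p∩q⁻ p q x∈p∩q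
  ...   | x∈p , x∈q = x∈p∩q⁺ (x∈p∩q⁺ (x∈p , proj₂ (x∈p∩q⁻ (p ∪ q) g x∈[p∪q]∩g)) , x∈q)

subsetOfSize : ∀ {m} n (p : Subset m) → n ℕ.≤ ∣ p ∣ → ∃[ q ] (q ⊆ p × ∣ q ∣ ≡ n)
subsetOfSize {m} zero p _ = ⊥ , ⊥⊆ , ∣⊥∣≡0 m
subsetOfSize (suc n) (outside ∷ p) n<∣p∣ with subsetOfSize (suc n) p n<∣p∣
... | q , q⊆p , ∣q∣≡n = outside ∷ q , out⊆ q⊆p , ∣q∣≡n
subsetOfSize (suc n) (inside ∷ p) (s≤s n≤∣p∣) with subsetOfSize n p n≤∣p∣
... | q , q⊆p , ∣q∣≡n = inside ∷ q , in⊆in q⊆p , ≡.cong suc ∣q∣≡n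

∁-involutive : ∀ {m} (p : Subset m) → ∁ (∁ p) ≡ p
∁-involutive []      = ≡.refl
∁-involutive (x ∷ p) = ≡.cong₂ _∷_ (not-involutive x) (∁-involutive p)

∣p∩∁p∣≡0 : ∀ {m} (p : Subset m) → ∣ p ∩ ∁ p ∣ ≡ 0
∣p∩∁p∣≡0 {m} p = ≡.trans (≡.cong ∣_∣ (∩-inverseʳ p)) (∣⊥∣≡0 m)

∣++∣ : ∀ {m n} (p : Subset m) (q : Subset n) → ∣ p ++ q ∣ ≡ ∣ p ∣ ℕ.+ ∣ q ∣
∣++∣ []            q = ≡.refl
∣++∣ (outside ∷ p) q = ∣++∣ p q
∣++∣ (inside  ∷ p) q = ≡.cong suc (∣++∣ p q)

∣++∩++∣ : ∀ {m n} (p p′ : Subset m) (q q′ : Subset n) →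
          ∣ (p ++ q) ∩ (p′ ++ q′) ∣ ≡ ∣ p ∩ p′ ∣ ℕ.+ ∣ q ∩ q′ ∣
∣++∩++∣ p p′ q q′ = ≡.trans (≡.cong ∣_∣ (zipWith-++ _ p q p′ q′)) (∣++∣ (p ∩ p′) (q ∩ q′))

-- Disjoint blocks of equal size.

-- `suc q ℕ.* k` computes to `k ℕ.+ q ℕ.* k`: the first block fills the first `k` indices, and the
-- remaining ones are shifted past it by the prefix `⊥`.
blocks : ∀ q k → List (Subset (q ℕ.* k))
blocks zero    k = []
blocks (suc q) k = (⊤ {k} ++ ⊥) ∷ map (⊥ {n = k} ++_) (blocks q k)

length-blocks : ∀ q k → length (blocks q k) ≡ q
length-blocks zero    k = ≡.refl
length-blocks (suc q) k =
  ≡.cong suc (≡.trans (length-map _ (blocks q k)) (length-blocks q k))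

∣block∣≡k : ∀ q k → All (λ G → ∣ G ∣ ≡ k) (blocks q k)
∣block∣≡k zero    k = []
∣block∣≡k (suc q) k = ∣⊤++⊥∣≡k ∷ All.map⁺ (All.map ∣⊥++G∣≡k (∣block∣≡k q k))
  where
  open ≡.≡-Reasoning
  ∣⊤++⊥∣≡k : ∣ ⊤ {k} ++ ⊥ {q ℕ.* k} ∣ ≡ k
  ∣⊤++⊥∣≡k = begin
    ∣ ⊤ {k} ++ ⊥ {q ℕ.* k} ∣       ≡⟨ ∣++∣ (⊤ {k}) ⊥ ⟩
    ∣ ⊤ {k} ∣ ℕ.+ ∣ ⊥ {q ℕ.* k} ∣ ≡⟨ ≡.cong₂ ℕ._+_ (∣⊤∣≡n k) (∣⊥∣≡0 (q ℕ.* k)) ⟩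
    k ℕ.+ 0                       ≡⟨ ℕ.+-identityʳ k ⟩
    k                             ∎
  ∣⊥++G∣≡k : ∀ {G : Subset (q ℕ.* k)} → ∣ G ∣ ≡ k → ∣ ⊥ {k} ++ G ∣ ≡ k
  ∣⊥++G∣≡k {G} ∣G∣≡k = ≡.trans (∣++∣ (⊥ {k}) G) (≡.cong₂ ℕ._+_ (∣⊥∣≡0 k) ∣G∣≡k)

-- The blocks are disjoint: after splitting `p` at index `k`, the first block sees only `p₁` and all
-- others see only `p₂`.
∑∣p∩block∣≤∣p∣ : ∀ q k (p : Subset (q ℕ.* k)) →
                sum (map (λ G → ∣ p ∩ G ∣) (blocks q k)) ℕ.≤ ∣ p ∣
∑∣p∩block∣≤∣p∣ zero    k p = z≤n
∑∣p∩block∣≤∣p∣ (suc q) k p with splitAt k p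
... | p₁ , p₂ , ≡.refl = begin
  ∣ (p₁ ++ p₂) ∩ (⊤ {k} ++ ⊥) ∣ ℕ.+ sum (map (λ G → ∣ (p₁ ++ p₂) ∩ G ∣) (map (⊥ {k} ++_) Gs))
    ≤⟨ ℕ.+-mono-≤ (ℕ.≤-reflexive first) (ℕ.≤-reflexive (≡.cong sum rest)) ⟩
  ∣ p₁ ∣ ℕ.+ sum (map (λ G → ∣ p₂ ∩ G ∣) Gs)
    ≤⟨ ℕ.+-monoʳ-≤ ∣ p₁ ∣ (∑∣p∩block∣≤∣p∣ q k p₂) ⟩
  ∣ p₁ ∣ ℕ.+ ∣ p₂ ∣ ≡⟨ ∣++∣ p₁ p₂ ⟨
  ∣ p₁ ++ p₂ ∣      ∎
  where
  open ℕ.≤-Reasoning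
  Gs = blocks q k
  ∣∩⊥∣≡0 : ∀ {n} (p : Subset n) → ∣ p ∩ ⊥ ∣ ≡ 0
  ∣∩⊥∣≡0 {n} p = ≡.trans (≡.cong ∣_∣ (∩-zeroʳ p)) (∣⊥∣≡0 n)
  first : ∣ (p₁ ++ p₂) ∩ (⊤ {k} ++ ⊥) ∣ ≡ ∣ p₁ ∣
  first = ≡.trans (∣++∩++∣ p₁ ⊤ p₂ ⊥)
    (≡.trans (≡.cong₂ ℕ._+_ (≡.cong ∣_∣ (∩-identityʳ p₁)) (∣∩⊥∣≡0 p₂)) (ℕ.+-identityʳ ∣ p₁ ∣))
  rest : map (λ G → ∣ (p₁ ++ p₂) ∩ G ∣) (map (⊥ {k} ++_) Gs) ≡ map (λ G → ∣ p₂ ∩ G ∣) Gs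
  rest = ≡.trans (≡.sym (map-∘ Gs))
    (map-cong (λ G → ≡.trans (∣++∩++∣ p₁ ⊥ p₂ G) (≡.cong (ℕ._+ ∣ p₂ ∩ G ∣) (∣∩⊥∣≡0 p₁))) Gs)

-- The hard objective, with natural values.

-- Before the last element w arrives, all elements are worth 1.  Then w is worth
-- k but makes every element outside the hidden set G worthless.
trap : ∀ {m} → ℕ → Subset m → Subset (suc m) → ℕ
trap k G (outside ∷ S) = ∣ S ∣
trap k G (inside  ∷ S) = k ℕ.+ ∣ S ∩ G ∣

-- If both sets avoid w, or both contain it, equality holds, because cardinality and its trace on
-- `G` are modular. Only a mixed pair can be strict, and there `∣[p∪q]∩g∣+∣p∩q∣≤∣p∩g∣+∣q∣` applies.
trap-submodular : ∀ {m} k (G : Subset m) S T →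
  trap k G (S ∪ T) ℕ.+ trap k G (S ∩ T) ℕ.≤ trap k G S ℕ.+ trap k G T
trap-submodular k G (outside ∷ S) (outside ∷ T) = ℕ.≤-reflexive (∣p∪q∣+∣p∩q∣≡∣p∣+∣q∣ S T)
trap-submodular k G (inside ∷ S) (outside ∷ T) = begin
  k ℕ.+ ∣ (S ∪ T) ∩ G ∣ ℕ.+ ∣ S ∩ T ∣   ≡⟨ ℕ.+-assoc k _ _ ⟩
  k ℕ.+ (∣ (S ∪ T) ∩ G ∣ ℕ.+ ∣ S ∩ T ∣) ≤⟨ ℕ.+-monoʳ-≤ k (∣[p∪q]∩g∣+∣p∩q∣≤∣p∩g∣+∣q∣ S T G) ⟩
  k ℕ.+ (∣ S ∩ G ∣ ℕ.+ ∣ T ∣)           ≡⟨ ℕ.+-assoc k _ _ ⟨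
  k ℕ.+ ∣ S ∩ G ∣ ℕ.+ ∣ T ∣             ∎
  where open ℕ.≤-Reasoning
trap-submodular k G (outside ∷ S) (inside ∷ T)
  rewrite ∪-comm S T | ∩-comm S T | ℕ.+-comm ∣ S ∣ (k ℕ.+ ∣ T ∩ G ∣) =
  trap-submodular k G (inside ∷ T) (outside ∷ S)
trap-submodular k G (inside ∷ S) (inside ∷ T) = ℕ.≤-reflexive (begin
  k ℕ.+ ∣ (S ∪ T) ∩ G ∣ ℕ.+ (k ℕ.+ ∣ (S ∩ T) ∩ G ∣)
    ≡⟨ interchange k _ k _ ⟩
  k ℕ.+ k ℕ.+ (∣ (S ∪ T) ∩ G ∣ ℕ.+ ∣ (S ∩ T) ∩ G ∣)
    ≡⟨ ≡.cong₂ (λ p q → k ℕ.+ k ℕ.+ (∣ p ∣ ℕ.+ ∣ q ∣)) (∩-distribʳ-∪ G S T) (∩-distribʳ-∩ G S T) ⟩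
  k ℕ.+ k ℕ.+ (∣ (S ∩ G) ∪ (T ∩ G) ∣ ℕ.+ ∣ (S ∩ G) ∩ (T ∩ G) ∣)
    ≡⟨ ≡.cong (k ℕ.+ k ℕ.+_) (∣p∪q∣+∣p∩q∣≡∣p∣+∣q∣ (S ∩ G) (T ∩ G)) ⟩
  k ℕ.+ k ℕ.+ (∣ S ∩ G ∣ ℕ.+ ∣ T ∩ G ∣)
    ≡⟨ interchange k k _ _ ⟩
  k ℕ.+ ∣ S ∩ G ∣ ℕ.+ (k ℕ.+ ∣ T ∩ G ∣) ∎)
  where
  open ≡.≡-Reasoning
  open import Algebra.Properties.CommutativeSemigroup ℕ.+-commutativeSemigroup using (interchange)

-- The critical case is the arrival of w: it devalues at most `∣ ∁ G ∣` elements of `S`, and its own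
-- worth `k` makes up for them.
trap-monotone : ∀ {m} k (G : Subset m) → ∣ ∁ G ∣ ℕ.≤ k →
                ∀ S T → S ⊆ T → trap k G S ℕ.≤ trap k G T
trap-monotone k G _ (outside ∷ S) (outside ∷ T) S⊆T = p⊆q⇒∣p∣≤∣q∣ (drop-∷-⊆ S⊆T)
trap-monotone k G _ (inside  ∷ S) (inside  ∷ T) S⊆T =
  ℕ.+-monoʳ-≤ k (p⊆q⇒∣p∣≤∣q∣ (∩-monoˡ-⊆ G (drop-∷-⊆ S⊆T)))
trap-monotone k G _ (inside  ∷ S) (outside ∷ T) S⊆T with () ← S⊆T here
trap-monotone k G ∣∁G∣≤k (outside ∷ S) (inside ∷ T) S⊆T = begin
  ∣ S ∣                   ≤⟨ p⊆q⇒∣p∣≤∣q∣ S⊆∁G∪[T∩G] ⟩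
  ∣ ∁ G ∪ (T ∩ G) ∣       ≤⟨ ∣p∪q∣≤∣p∣+∣q∣ (∁ G) (T ∩ G) ⟩
  ∣ ∁ G ∣ ℕ.+ ∣ T ∩ G ∣   ≤⟨ ℕ.+-monoˡ-≤ _ ∣∁G∣≤k ⟩
  k ℕ.+ ∣ T ∩ G ∣         ∎
  where
  open ℕ.≤-Reasoning
  S⊆∁G∪[T∩G] : S ⊆ ∁ G ∪ (T ∩ G)
  S⊆∁G∪[T∩G] {x} x∈S with x ∈? G
  ... | yes x∈G = x∈p∪q⁺ (inj₂ (x∈p∩q⁺ (drop-∷-⊆ S⊆T x∈S , x∈G)))
  ... | no  x∉G = x∈p∪q⁺ (inj₁ (x∉p⇒x∈∁p x∉G))

-- This is `2 k - 1` for `k = suc N`; taking `N` as the parameter avoids truncated subtraction.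
optimum : ℕ → ℕ
optimum N = suc N ℕ.+ N

trap-optimum : ∀ {m} N (G : Subset m) → N ℕ.≤ ∣ G ∣ →
  ∃[ S ] (∣ S ∣ ≡ suc N × trap (suc N) G S ≡ optimum N)
trap-optimum N G N≤∣G∣ with subsetOfSize N G N≤∣G∣
... | T , T⊆G , ∣T∣≡N = inside ∷ T , ≡.cong suc ∣T∣≡N , ≡.cong (suc N ℕ.+_) (begin
  ∣ T ∩ G ∣ ≡⟨ ≡.cong ∣_∣ (p⊆q⇒p∩q≡p T⊆G) ⟩
  ∣ T ∣     ≡⟨ ∣T∣≡N ⟩
  N         ∎)
  where
  open ≡.≡-Reasoning
  p⊆q⇒p∩q≡p : ∀ {m} {p q : Subset m} → p ⊆ q → p ∩ q ≡ p
  p⊆q⇒p∩q≡p p⊆q = ⊆-antisym (p∩q⊆p _ _) (λ x∈p → x∈p∩q⁺ (x∈p , p⊆q x∈p))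

trap≤optimum : ∀ {m} N (G : Subset m) S → ∣ S ∣ ℕ.≤ suc N → trap (suc N) G S ℕ.≤ optimum N
trap≤optimum N G (outside ∷ S) ∣S∣≤k     = ℕ.m≤n⇒m≤n+o N ∣S∣≤k
trap≤optimum N G (inside  ∷ S) (s≤s ∣S∣≤N) =
  ℕ.+-monoʳ-≤ (suc N) (ℕ.≤-trans (∣p∩q∣≤∣p∣ S G) ∣S∣≤N)

-- Here `T` stands for the set held just before w. If w is rejected, feasibility caps the value at
-- `k`; if w is taken, whatever accompanies it was already in `T` and counts only inside `G`.
trap-after : ∀ {m} k (G T : Subset m) S → S ⊆ inside ∷ T → ∣ S ∣ ℕ.≤ k →
             trap k G S ℕ.≤ k ℕ.+ ∣ T ∩ G ∣
trap-after k G T (outside ∷ S) _   ∣S∣≤k = ℕ.m≤n⇒m≤n+o _ ∣S∣≤k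
trap-after k G T (inside  ∷ S) S⊆T _     =
  ℕ.+-monoʳ-≤ k (p⊆q⇒∣p∣≤∣q∣ (∩-monoˡ-⊆ G (drop-∷-⊆ S⊆T)))

-- Order and natural multiples in the real numbers.

module OrderedField {c ℓ₁ ℓ₂} (R : RealNumbers c ℓ₁ ℓ₂) where

  open RealNumbers R public
  open import Algebra.Properties.Semiring.Mult
    (CommutativeRing.semiring commutativeRing) using (×-homo-+; ×1-homo-*)
  open import Algebra.Apartness.Properties.HeytingCommutativeRing heytingCommutativeRing
    using (x-0≈x)

  -- The order need not be decidable; ≤ is transitive because < is cotransitive.
  <-≤-trans : ∀ {x y z} → x < y → y ≤ z → x < z
  <-≤-trans {x} {y} {z} x<y y≤z
    with #-cotrans (Equivalence.from #⇔<⊎> (inj₁ x<y)) z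
  ... | inj₁ x#z with Equivalence.to #⇔<⊎> x#z
  ...   | inj₁ x<z = x<z
  ...   | inj₂ z<x = ⊥-elim (y≤z (<-trans z<x x<y))
  <-≤-trans {x} {y} {z} x<y y≤z | inj₂ z#y with Equivalence.to #⇔<⊎> z#y
  ...   | inj₁ z<y = ⊥-elim (y≤z z<y)
  ...   | inj₂ y<z = <-trans x<y y<z

  ≤-trans : ∀ {x y z} → x ≤ y → y ≤ z → x ≤ z
  ≤-trans x≤y y≤z z<x = y≤z (<-≤-trans z<x x≤y)

  ≤-<-trans : ∀ {x y z} → x ≤ y → y < z → x < z
  ≤-<-trans {x} {y} {z} x≤y y<z
    with #-cotrans (Equivalence.from #⇔<⊎> (inj₁ y<z)) x
  ... | inj₁ y#x with Equivalence.to #⇔<⊎> y#x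
  ...   | inj₁ y<x = ⊥-elim (x≤y y<x)
  ...   | inj₂ x<y = <-trans x<y y<z
  ≤-<-trans {x} {y} {z} x≤y y<z | inj₂ x#z with Equivalence.to #⇔<⊎> x#z
  ...   | inj₁ x<z = x<z
  ...   | inj₂ z<x = ⊥-elim (x≤y (<-trans y<z z<x))

  ≤-reflexive : ∀ {x y} → x ≈ y → x ≤ y
  ≤-reflexive x≈y y<x = <-irrefl (sym x≈y) y<x

  <⇒≤ : ∀ {x y} → x < y → x ≤ y
  <⇒≤ x<y y<x = <-irrefl refl (<-trans x<y y<x)

  ≤-isPreorder : IsPreorder _≈_ _≤_
  ≤-isPreorder = record
    { isEquivalence = isEquivalence ; reflexive = ≤-reflexive ; trans = ≤-trans }

  module ≤-Reasoning = Triple ≤-isPreorder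
    (λ x<y y<x → <-irrefl refl (<-trans x<y y<x)) <-trans
    (IsStrictPartialOrder.<-resp-≈ isStrictPartialOrder) <⇒≤ <-≤-trans ≤-<-trans

  +-cancelʳ-< : ∀ {x y} z → x + z < y + z → x < y
  +-cancelʳ-< z x+z<y+z =
    <-respˡ-≈ (x+z-z≈x _) (<-respʳ-≈ (x+z-z≈x _) (+-monoˡ-< (- z) x+z<y+z))
    where
    x+z-z≈x : ∀ x → x + z + - z ≈ x
    x+z-z≈x x = trans (+-assoc x z (- z)) (trans (+-congˡ (-‿inverseʳ z)) (+-identityʳ x))

  +-monoˡ-≤ : ∀ {x y} z → x ≤ y → x + z ≤ y + z
  +-monoˡ-≤ z x≤y y+z<x+z = x≤y (+-cancelʳ-< z y+z<x+z)

  +-monoʳ-≤ : ∀ {x y} z → x ≤ y → z + x ≤ z + y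
  +-monoʳ-≤ {x} {y} z x≤y =
    ≤-trans (≤-reflexive (+-comm z x)) (≤-trans (+-monoˡ-≤ z x≤y) (≤-reflexive (+-comm y z)))

  +-mono-≤ : ∀ {w x y z} → w ≤ x → y ≤ z → w + y ≤ x + z
  +-mono-≤ w≤x y≤z = ≤-trans (+-monoˡ-≤ _ w≤x) (+-monoʳ-≤ _ y≤z)

  fromℕ-+ : ∀ m n → fromℕ (m ℕ.+ n) ≈ fromℕ m + fromℕ n
  fromℕ-+ = ×-homo-+ 1#

  fromℕ-* : ∀ m n → fromℕ (m ℕ.* n) ≈ fromℕ m * fromℕ n
  fromℕ-* = ×1-homo-*

  0≤fromℕ : ∀ n → 0# ≤ fromℕ n
  0≤fromℕ zero    = ≤-reflexive refl
  0≤fromℕ (suc n) = <⇒≤ (0<fromℕ n)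

  *-distribˡ-fromℕ-+ : ∀ x m n → x * fromℕ (m ℕ.+ n) ≈ x * fromℕ m + x * fromℕ n
  *-distribˡ-fromℕ-+ x m n = trans (*-congˡ (fromℕ-+ m n)) (distribˡ x (fromℕ m) (fromℕ n))

  *-fromℕ-suc : ∀ x n → x * fromℕ (suc n) ≈ x + x * fromℕ n
  *-fromℕ-suc x n = trans (distribˡ x 1# (fromℕ n)) (+-congʳ (*-identityʳ x))

  *-fromℕ-assoc : ∀ x m n → x * fromℕ (m ℕ.* n) ≈ x * fromℕ m * fromℕ n
  *-fromℕ-assoc x m n = trans (*-congˡ (fromℕ-* m n)) (sym (*-assoc x (fromℕ m) (fromℕ n)))

  -- A natural factor is repeated addition, so monotonicity of addition suffices, whatever the signs
  -- of `x` and `y`.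
  *-fromℕ-monoˡ-≤ : ∀ {x y} n → x ≤ y → x * fromℕ n ≤ y * fromℕ n
  *-fromℕ-monoˡ-≤ {x} {y} zero x≤y = ≤-reflexive (trans (zeroʳ x) (sym (zeroʳ y)))
  *-fromℕ-monoˡ-≤ {x} {y} (suc n) x≤y = begin
    x * fromℕ (suc n)  ≈⟨ *-fromℕ-suc x n ⟩
    x + x * fromℕ n    ≤⟨ +-mono-≤ x≤y (*-fromℕ-monoˡ-≤ n x≤y) ⟩
    y + y * fromℕ n    ≈⟨ *-fromℕ-suc y n ⟨
    y * fromℕ (suc n)  ∎
    where open ≤-Reasoning

  *-fromℕ-monoʳ-≤ : ∀ {x m n} → 0# ≤ x → m ℕ.≤ n → x * fromℕ m ≤ x * fromℕ n
  *-fromℕ-monoʳ-≤ {x} {m} 0≤x m≤n with o , ≡.refl ← ℕ.m≤n⇒∃[o]m+o≡n m≤n = begin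
    x * fromℕ m                ≈⟨ +-identityʳ (x * fromℕ m) ⟨
    x * fromℕ m + 0#           ≈⟨ +-congˡ (zeroˡ (fromℕ o)) ⟨
    x * fromℕ m + 0# * fromℕ o ≤⟨ +-monoʳ-≤ _ (*-fromℕ-monoˡ-≤ o 0≤x) ⟩
    x * fromℕ m + x * fromℕ o  ≈⟨ *-distribˡ-fromℕ-+ x m o ⟨
    x * fromℕ (m ℕ.+ o)        ∎
    where open ≤-Reasoning

  fromℕ-mono-≤ : ∀ {m n} → m ℕ.≤ n → fromℕ m ≤ fromℕ n
  fromℕ-mono-≤ {m} {n} m≤n = begin
    fromℕ m       ≈⟨ *-identityˡ (fromℕ m) ⟨
    1# * fromℕ m  ≤⟨ *-fromℕ-monoʳ-≤ (<⇒≤ 0<1) m≤n ⟩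
    1# * fromℕ n  ≈⟨ *-identityˡ (fromℕ n) ⟩
    fromℕ n       ∎
    where open ≤-Reasoning

  fromℕ-mono-< : ∀ {m n} → m ℕ.< n → fromℕ m < fromℕ n
  fromℕ-mono-< {m} {n} m<n = begin-strict
    fromℕ m        ≈⟨ +-identityˡ (fromℕ m) ⟨
    0# + fromℕ m   <⟨ +-monoˡ-< (fromℕ m) 0<1 ⟩
    fromℕ (suc m)  ≤⟨ fromℕ-mono-≤ m<n ⟩
    fromℕ n        ∎
    where open ≤-Reasoning

  -- The Archimedean axiom gives `N` above `ε⁻¹`; strictness then comes from the positive product of
  -- `ε` and `fromℕ N - ε⁻¹`.
  1<multiple : ∀ ε → 0# < ε → ∃[ N ] 1# < ε * fromℕ N
  1<multiple ε 0<ε with #⇒invertible (Equivalence.from #⇔<⊎> (inj₂ 0<ε))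
  ... | ε⁻¹ , _ , ε*ε⁻¹≈1 with archimedean ε⁻¹
  ...   | N , ε⁻¹<N = N , (begin-strict
    1#                                   ≈⟨ +-identityˡ 1# ⟨
    0# + 1#                              <⟨ +-monoˡ-< 1# (*-pos 0<ε 0<N-ε⁻¹) ⟩
    -- The inverse supplied by the field axioms is that of `ε - 0#`, hence `x-0≈x`.
    ε * (fromℕ N - ε⁻¹) + 1#             ≈⟨ +-congˡ (trans (*-congʳ (sym (x-0≈x ε))) ε*ε⁻¹≈1) ⟨
    ε * (fromℕ N - ε⁻¹) + ε * ε⁻¹        ≈⟨ distribˡ ε (fromℕ N - ε⁻¹) ε⁻¹ ⟨
    ε * (fromℕ N - ε⁻¹ + ε⁻¹)            ≈⟨ *-congˡ (+-assoc (fromℕ N) (- ε⁻¹) ε⁻¹) ⟩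
    ε * (fromℕ N + (- ε⁻¹ + ε⁻¹))        ≈⟨ *-congˡ (+-congˡ (-‿inverseˡ ε⁻¹)) ⟩
    ε * (fromℕ N + 0#)                   ≈⟨ *-congˡ (+-identityʳ (fromℕ N)) ⟩
    ε * fromℕ N                          ∎)
    where
    open ≤-Reasoning
    0<N-ε⁻¹ : 0# < fromℕ N - ε⁻¹
    0<N-ε⁻¹ = <-respˡ-≈ (-‿inverseʳ ε⁻¹) (+-monoˡ-< (- ε⁻¹) ε⁻¹<N)

  -- Cleared of denominators, (a / b + ε) P exceeds B as soon as the slack D
  -- between a P and b B is paid for by ε b P ≥ ε N D ≥ D.
  ratio-exceeds : ∀ a b .{{_ : NonZero b}} {ε} N → 0# < ε → 1# < ε * fromℕ N → ∀ P B D →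
    b ℕ.* B ℕ.< a ℕ.* P ℕ.+ D → N ℕ.* D ℕ.≤ b ℕ.* P → ¬ ((a / b + ε) * fromℕ P ≤ fromℕ B)
  ratio-exceeds a b {ε} N 0<ε 1<εN P B D bB<aP+D ND≤bP αP≤B = <-irrefl refl (begin-strict
    fromℕ (b ℕ.* B)                               <⟨ fromℕ-mono-< bB<aP+D ⟩
    fromℕ (a ℕ.* P ℕ.+ D)                         ≈⟨ fromℕ-+ (a ℕ.* P) D ⟩
    fromℕ (a ℕ.* P) + fromℕ D                     ≤⟨ +-monoʳ-≤ _ D≤εbP ⟩
    fromℕ (a ℕ.* P) + ε * fromℕ (b ℕ.* P)         ≈⟨ +-cong aP≈ εbP≈ ⟩
    a / b * fromℕ P * fromℕ b + ε * fromℕ P * fromℕ b ≈⟨ distribʳ (fromℕ b) _ _ ⟨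
    (a / b * fromℕ P + ε * fromℕ P) * fromℕ b     ≈⟨ *-congʳ (distribʳ (fromℕ P) (a / b) ε) ⟨
    (a / b + ε) * fromℕ P * fromℕ b               ≤⟨ *-fromℕ-monoˡ-≤ b αP≤B ⟩
    fromℕ B * fromℕ b                             ≈⟨ *-comm (fromℕ B) (fromℕ b) ⟩
    fromℕ b * fromℕ B                             ≈⟨ fromℕ-* b B ⟨
    fromℕ (b ℕ.* B)                               ∎)
    where
    open ≤-Reasoning
    open CommutativeRing commutativeRing using (*-commutativeSemigroup)
    open import Algebra.Properties.CommutativeSemigroup *-commutativeSemigroup using (xy∙z≈x∙zy)
    D≤εbP : fromℕ D ≤ ε * fromℕ (b ℕ.* P)
    D≤εbP = begin
      fromℕ D                 ≈⟨ *-identityˡ (fromℕ D) ⟨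
      1# * fromℕ D            ≤⟨ *-fromℕ-monoˡ-≤ D (<⇒≤ 1<εN) ⟩
      ε * fromℕ N * fromℕ D   ≈⟨ *-fromℕ-assoc ε N D ⟨
      ε * fromℕ (N ℕ.* D)     ≤⟨ *-fromℕ-monoʳ-≤ (<⇒≤ 0<ε) ND≤bP ⟩
      ε * fromℕ (b ℕ.* P)     ∎
    aP≈ : fromℕ (a ℕ.* P) ≈ a / b * fromℕ P * fromℕ b
    aP≈ = begin-equality
      fromℕ (a ℕ.* P)           ≈⟨ fromℕ-* a P ⟩
      fromℕ a * fromℕ P         ≈⟨ *-congʳ (/-inverse a b) ⟨
      a / b * fromℕ b * fromℕ P ≈⟨ trans (xy∙z≈x∙zy _ _ _) (sym (*-assoc _ _ _)) ⟩
      a / b * fromℕ P * fromℕ b ∎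
    εbP≈ : ε * fromℕ (b ℕ.* P) ≈ ε * fromℕ P * fromℕ b
    εbP≈ = begin-equality
      ε * fromℕ (b ℕ.* P)       ≡⟨ ≡.cong (λ n → ε * fromℕ n) (ℕ.*-comm b P) ⟩
      ε * fromℕ (P ℕ.* b)       ≈⟨ *-fromℕ-assoc ε P b ⟩
      ε * fromℕ P * fromℕ b     ∎

module _ {c ℓ₁ ℓ₂} (R : RealNumbers c ℓ₁ ℓ₂) where

  open OrderedField R using
    ( ≤-reflexive; ≤-trans; +-mono-≤; fromℕ-+
    ; *-distribˡ-fromℕ-+; *-fromℕ-suc; *-fromℕ-assoc; *-fromℕ-monoʳ-≤; fromℕ-mono-≤; 0≤fromℕ
    ; ratio-exceeds; module ≤-Reasoning)
  open CardinalityModel R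
  open import Algebra.Properties.CommutativeSemigroup
    (CommutativeMonoid.commutativeSemigroup (CommutativeRing.+-commutativeMonoid commutativeRing))
    using (interchange)
  open import Algebra.Properties.AbelianGroup (CommutativeRing.+-abelianGroup commutativeRing)
    using (identityˡ-unique)

  -- Sums over all subsets.

  sumOverSubsets-cong : ∀ {n} {g h : Subset n → ℝ} → (∀ S → g S ≈ h S) →
                        sumOverSubsets g ≈ sumOverSubsets h
  sumOverSubsets-cong {zero}  g≈h = g≈h []
  sumOverSubsets-cong {suc n} g≈h =
    +-cong (sumOverSubsets-cong (g≈h ∘ (outside ∷_))) (sumOverSubsets-cong (g≈h ∘ (inside ∷_)))

  sumOverSubsets-mono : ∀ {n} {g h : Subset n → ℝ} → (∀ S → g S ≤ h S) →
                        sumOverSubsets g ≤ sumOverSubsets h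
  sumOverSubsets-mono {zero}  g≤h = g≤h []
  sumOverSubsets-mono {suc n} g≤h =
    +-mono-≤ (sumOverSubsets-mono (g≤h ∘ (outside ∷_))) (sumOverSubsets-mono (g≤h ∘ (inside ∷_)))

  sumOverSubsets-+ : ∀ {n} (g h : Subset n → ℝ) →
    sumOverSubsets (λ S → g S + h S) ≈ sumOverSubsets g + sumOverSubsets h
  sumOverSubsets-+ {zero}  g h = refl
  sumOverSubsets-+ {suc n} g h = trans
    (+-cong (sumOverSubsets-+ (g ∘ (outside ∷_)) (h ∘ (outside ∷_)))
            (sumOverSubsets-+ (g ∘ (inside ∷_)) (h ∘ (inside ∷_))))
    (interchange _ _ _ _)

  sumOverSubsets-0 : ∀ n → sumOverSubsets {n} (λ _ → 0#) ≈ 0#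
  sumOverSubsets-0 zero    = refl
  sumOverSubsets-0 (suc n) =
    trans (+-cong (sumOverSubsets-0 n) (sumOverSubsets-0 n)) (+-identityʳ 0#)

  sumOverSubsets-*ʳ : ∀ {n} (g : Subset n → ℝ) x →
    sumOverSubsets (λ S → g S * x) ≈ sumOverSubsets g * x
  sumOverSubsets-*ʳ {zero}  g x = refl
  sumOverSubsets-*ʳ {suc n} g x = trans
    (+-cong (sumOverSubsets-*ʳ (g ∘ (outside ∷_)) x) (sumOverSubsets-*ʳ (g ∘ (inside ∷_)) x))
    (sym (distribʳ x _ _))

  sumOverSubsets-swap : ∀ {m n} (g : Subset m → Subset n → ℝ) →
    sumOverSubsets (λ S → sumOverSubsets (g S)) ≈
    sumOverSubsets (λ T → sumOverSubsets (λ S → g S T))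
  sumOverSubsets-swap {zero}  g = refl
  sumOverSubsets-swap {suc m} {n} g = trans
    (+-cong (sumOverSubsets-swap (g ∘ (outside ∷_))) (sumOverSubsets-swap (g ∘ (inside ∷_))))
    (sym (sumOverSubsets-+ {n = n} _ _))

  -- Finite partitions of the probability space.

  module Probability {a e} (space : ProbabilitySpace a e) where

    open ProbabilitySpace space

    infix 4 _∋_
    infixr 7 _∩ᵉ_

    _∋_ : Event → Ω → Set
    B ∋ ω = occurs B ω ≡ true

    -- De Morgan's law, since events come with complement and union.
    _∩ᵉ_ : Event → Event → Event
    B ∩ᵉ C = ∁ᵉ (∁ᵉ B ∪ᵉ ∁ᵉ C)

    occurs-∩ : ∀ B C ω → occurs (B ∩ᵉ C) ω ≡ occurs B ω ∧ occurs C ω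
    occurs-∩ B C ω
      rewrite occurs-∁ (∁ᵉ B ∪ᵉ ∁ᵉ C) ω | occurs-∪ (∁ᵉ B) (∁ᵉ C) ω | occurs-∁ B ω | occurs-∁ C ω
      with occurs B ω | occurs C ω
    ... | true  | true  = ≡.refl
    ... | true  | false = ≡.refl
    ... | false | _     = ≡.refl

    ∋-∩⁻ : ∀ B C {ω} → B ∩ᵉ C ∋ ω → (B ∋ ω) × (C ∋ ω)
    ∋-∩⁻ B C {ω} ∋∩ with occurs B ω | occurs C ω | ≡.trans (≡.sym (occurs-∩ B C ω)) ∋∩
    ... | true | true | _ = ≡.refl , ≡.refl

    ∋-∩⁺ : ∀ B C {ω} → B ∋ ω → C ∋ ω → B ∩ᵉ C ∋ ω
    ∋-∩⁺ B C {ω} ∋B ∋C = ≡.trans (occurs-∩ B C ω) (≡.cong₂ _∧_ ∋B ∋C)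

    ℙ-cong-⇔ : ∀ B C → (∀ ω → B ∋ ω → C ∋ ω) → (∀ ω → C ∋ ω → B ∋ ω) → ℙ B ≈ ℙ C
    ℙ-cong-⇔ B C B⊆C C⊆B = ℙ-cong B C (λ ω → ⇔→≡ (mk⇔ (B⊆C ω) (C⊆B ω)))

    -- An event that never occurs is disjoint from itself, so additivity gives `ℙ B + ℙ B ≈ ℙ B`,
    -- and one copy cancels.
    ℙ-impossible : ∀ B → (∀ ω → ¬ (B ∋ ω)) → ℙ B ≈ 0#
    ℙ-impossible B ∌B = identityˡ-unique (ℙ B) (ℙ B) (trans (sym (ℙ-additive B B disjoint))
      (ℙ-cong (B ∪ᵉ B) B (λ ω → ≡.trans (occurs-∪ B B ω) (∨-idem (occurs B ω)))))
      where
      disjoint : ∀ ω → occurs B ω ∧ occurs B ω ≡ false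
      disjoint ω = ≡.trans (∧-idem (occurs B ω)) (¬-not (∌B ω))

    -- The recursion is that of `sumOverSubsets`, so additivity can be applied branch by branch.
    ⋃ : ∀ {n} → (Subset n → Event) → Event
    ⋃ {zero}  E = E []
    ⋃ {suc n} E = ⋃ (E ∘ (outside ∷_)) ∪ᵉ ⋃ (E ∘ (inside ∷_))

    ∋-⋃⁺ : ∀ {n} (E : Subset n → Event) S {ω} → E S ∋ ω → ⋃ E ∋ ω
    ∋-⋃⁺ E []            ∋E = ∋E
    ∋-⋃⁺ E (outside ∷ S) {ω} ∋E
      rewrite occurs-∪ (⋃ (E ∘ (outside ∷_))) (⋃ (E ∘ (inside ∷_))) ω
            | ∋-⋃⁺ (E ∘ (outside ∷_)) S ∋E = ≡.refl
    ∋-⋃⁺ E (inside ∷ S) {ω} ∋E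
      rewrite occurs-∪ (⋃ (E ∘ (outside ∷_))) (⋃ (E ∘ (inside ∷_))) ω
            | ∋-⋃⁺ (E ∘ (inside ∷_)) S ∋E = ∨-zeroʳ _

    ∋-⋃⁻ : ∀ {n} (E : Subset n → Event) {ω} → ⋃ E ∋ ω → ∃[ S ] (E S ∋ ω)
    ∋-⋃⁻ {zero}  E ∋E = [] , ∋E
    ∋-⋃⁻ {suc n} E {ω} ∋⋃
      with occurs (⋃ (E ∘ (outside ∷_))) ω in eqₒ | occurs (⋃ (E ∘ (inside ∷_))) ω in eqᵢ
         | ≡.trans (≡.sym (occurs-∪ _ _ ω)) ∋⋃
    ... | true  | _    | _ with S , ∋E ← ∋-⋃⁻ (E ∘ (outside ∷_)) eqₒ = outside ∷ S , ∋E
    ... | false | true | _ with S , ∋E ← ∋-⋃⁻ (E ∘ (inside ∷_)) eqᵢ = inside ∷ S , ∋E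

    ℙ-⋃ : ∀ {n} (E : Subset n → Event) → (∀ {S T} ω → E S ∋ ω → E T ∋ ω → S ≡ T) →
          ℙ (⋃ E) ≈ sumOverSubsets (ℙ ∘ E)
    ℙ-⋃ {zero}  E _        = refl
    ℙ-⋃ {suc n} E disjoint = trans
      (ℙ-additive _ _ (λ ω → ¬-not (no-overlap ω)))
      (+-cong (ℙ-⋃ (E ∘ (outside ∷_)) (λ ω ∋S ∋T → ∷-injectiveʳ (disjoint ω ∋S ∋T)))
              (ℙ-⋃ (E ∘ (inside ∷_)) (λ ω ∋S ∋T → ∷-injectiveʳ (disjoint ω ∋S ∋T))))
      where
      no-overlap : ∀ ω → ¬ (occurs (⋃ (E ∘ (outside ∷_))) ω ∧ occurs (⋃ (E ∘ (inside ∷_))) ω ≡ true)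
      no-overlap ω ∋both
        with S , ∋S ← ∋-⋃⁻ (E ∘ (outside ∷_)) (∧-conicalˡ _ _ ∋both)
           | T , ∋T ← ∋-⋃⁻ (E ∘ (inside ∷_)) (∧-conicalʳ _ _ ∋both)
        -- A common outcome would identify `outside ∷ S` with `inside ∷ T`.
        with () ← disjoint ω ∋S ∋T

    -- Law of total probability: the events `E S` are the fibres of `X`, hence pairwise disjoint and
    -- jointly exhaustive.
    ℙ-total : ∀ {n} (X : Ω → Subset n) (E : Subset n → Event) →
              (∀ S ω → (E S ∋ ω) ⇔ (X ω ≡ S)) →
              ∀ B → ℙ B ≈ sumOverSubsets (λ S → ℙ (B ∩ᵉ E S))
    ℙ-total X E E⇔ B = trans
      (ℙ-cong-⇔ B (⋃ (λ S → B ∩ᵉ E S))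
        (λ ω ∋B → ∋-⋃⁺ _ (X ω) (∋-∩⁺ B (E (X ω)) ∋B (Equivalence.from (E⇔ (X ω) ω) ≡.refl)))
        (λ ω ∋⋃ → let S , ∋B∩E = ∋-⋃⁻ _ ∋⋃ in proj₁ (∋-∩⁻ B (E S) ∋B∩E)))
      (ℙ-⋃ (λ S → B ∩ᵉ E S) (λ {S} {T} ω ∋S ∋T →
        ≡.trans (≡.sym (Equivalence.to (E⇔ S ω) (proj₂ (∋-∩⁻ B (E S) ∋S))))
                (Equivalence.to (E⇔ T ω) (proj₂ (∋-∩⁻ B (E T) ∋T)))))

  -- Averaging the expected values over several instances.

  module _ {a e} (A : RandomizedAlgorithm a e) (k : ℕ) {n : ℕ} where

    open RandomizedAlgorithm A
    open Probability probabilitySpace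

    -- Objectives are natural-valued and embedded by `fromℕ`, so bounds for a fixed `ω` live in ℕ,
    -- where the order is decidable.
    value : Ω → (Subset n → ℕ) → ℕ
    value ω v = v (solution ω k (fromℕ ∘ v))

    returned : (Subset n → ℕ) → Subset n → Event
    returned v = returns k (fromℕ ∘ v)

    -- The expectation of the value times the indicator of `B`. It is not divided by `ℙ B`, so it
    -- adds up over partitions and makes sense for null events.
    expectedOn : Event → (Subset n → ℕ) → ℝ
    expectedOn B v = sumOverSubsets (λ S → ℙ (B ∩ᵉ returned v S) * fromℕ (v S))

    totalOn : Event → List (Subset n → ℕ) → ℝ
    totalOn B []       = 0#
    totalOn B (v ∷ vs) = expectedOn B v + totalOn B vs

    ℙ-split : ∀ v B → ℙ B ≈ sumOverSubsets (λ S → ℙ (B ∩ᵉ returned v S))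
    ℙ-split v = ℙ-total (λ ω → solution ω k (fromℕ ∘ v)) (returned v) (occurs-returns k (fromℕ ∘ v))

    expectedOn-certain : ∀ v → expected A k (fromℕ ∘ v) ≈ expectedOn certain v
    expectedOn-certain v = sumOverSubsets-cong (λ S → *-congʳ (ℙ-cong-⇔ (returned v S) _
      (λ ω → ∋-∩⁺ certain (returned v S) (occurs-certain ω))
      (λ ω → proj₂ ∘ ∋-∩⁻ certain (returned v S))))

    -- Total expectation over the solutions for a second instance `u`: refine every probability by
    -- them, then exchange the two sums.
    expectedOn-split : ∀ u v B →
      expectedOn B v ≈ sumOverSubsets (λ S → expectedOn (B ∩ᵉ returned u S) v)
    expectedOn-split u v B = trans
      (sumOverSubsets-cong (λ T → begin
        ℙ (B ∩ᵉ V T) * fromℕ (v T)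
          ≈⟨ *-congʳ (ℙ-split u (B ∩ᵉ V T)) ⟩
        sumOverSubsets (λ S → ℙ ((B ∩ᵉ V T) ∩ᵉ U S)) * fromℕ (v T)
          ≈⟨ sumOverSubsets-*ʳ {n = n} _ _ ⟨
        sumOverSubsets (λ S → ℙ ((B ∩ᵉ V T) ∩ᵉ U S) * fromℕ (v T))
          ≈⟨ sumOverSubsets-cong (λ S → *-congʳ (ℙ-cong-⇔ _ _
               (λ _ → ∩-swap (V T) (U S)) (λ _ → ∩-swap (U S) (V T)))) ⟩
        sumOverSubsets (λ S → ℙ ((B ∩ᵉ U S) ∩ᵉ V T) * fromℕ (v T)) ∎))
      (sumOverSubsets-swap {n} {n} _)
      where
      open ≈-Reasoning (CommutativeRing.setoid commutativeRing)
      U = returned u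
      V = returned v
      ∩-swap : ∀ C D {ω} → (B ∩ᵉ C) ∩ᵉ D ∋ ω → (B ∩ᵉ D) ∩ᵉ C ∋ ω
      ∩-swap C D ∋∩ with ∋B∩C , ∋D ← ∋-∩⁻ (B ∩ᵉ C) D ∋∩ with ∋B , ∋C ← ∋-∩⁻ B C ∋B∩C =
        ∋-∩⁺ (B ∩ᵉ D) C (∋-∩⁺ B D ∋B ∋D) ∋C

    totalOn-split : ∀ u vs B →
      totalOn B vs ≈ sumOverSubsets (λ S → totalOn (B ∩ᵉ returned u S) vs)
    totalOn-split u []       B = sym (sumOverSubsets-0 n)
    totalOn-split u (v ∷ vs) B = trans
      (+-cong (expectedOn-split u v B) (totalOn-split u vs B)) (sym (sumOverSubsets-+ {n = n} _ _))

    -- Condition on the solutions of the instances one after another; b collects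
    -- the values of the instances already decided.
    totalOn-≤ : ∀ vs b t B →
      (∀ ω → B ∋ ω → sum (map (value ω) vs) ℕ.+ b ℕ.≤ t) →
      totalOn B vs + ℙ B * fromℕ b ≤ ℙ B * fromℕ t
    totalOn-≤ [] b t B b≤t = ≤-trans (≤-reflexive (+-identityˡ _)) bounded
      where
      bounded : ℙ B * fromℕ b ≤ ℙ B * fromℕ t
      -- Whether `B` has an outcome is not decidable, but `b ℕ.≤ t` is. If it fails, the hypothesis
      -- rules out every outcome of `B`, and both sides vanish.
      bounded with b ℕ.≤? t
      ... | yes p = *-fromℕ-monoʳ-≤ (ℙ-nonNeg B) p
      ... | no ¬p = ≤-reflexive (trans (vanishes b) (sym (vanishes t)))
        where
        vanishes : ∀ m → ℙ B * fromℕ m ≈ 0#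
        vanishes m = trans (*-congʳ (ℙ-impossible B (λ ω → ¬p ∘ b≤t ω))) (zeroˡ (fromℕ m))
    totalOn-≤ (v ∷ vs) b t B ∑≤t = begin
      expectedOn B v + totalOn B vs + ℙ B * fromℕ b
        ≈⟨ +-cong (+-comm _ _) (trans (*-congʳ (ℙ-split v B)) (sym (sumOverSubsets-*ʳ {n = n} _ _))) ⟩
      totalOn B vs + expectedOn B v + sumOverSubsets (λ S → ℙ (B′ S) * fromℕ b)
        ≈⟨ +-assoc _ _ _ ⟩
      totalOn B vs + (expectedOn B v + sumOverSubsets (λ S → ℙ (B′ S) * fromℕ b))
        ≈⟨ +-cong (totalOn-split v vs B)
             (trans (sym (sumOverSubsets-+ {n = n} _ _))
               (sumOverSubsets-cong (λ S → sym (*-distribˡ-fromℕ-+ (ℙ (B′ S)) (v S) b)))) ⟩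
      sumOverSubsets (λ S → totalOn (B′ S) vs) +
      sumOverSubsets (λ S → ℙ (B′ S) * fromℕ (v S ℕ.+ b))
        ≈⟨ sumOverSubsets-+ {n = n} _ _ ⟨
      sumOverSubsets (λ S → totalOn (B′ S) vs + ℙ (B′ S) * fromℕ (v S ℕ.+ b))
        ≤⟨ sumOverSubsets-mono (λ S → totalOn-≤ vs (v S ℕ.+ b) t (B′ S) (∑′≤t S)) ⟩
      sumOverSubsets (λ S → ℙ (B′ S) * fromℕ t)
        ≈⟨ trans (sumOverSubsets-*ʳ {n = n} _ _) (*-congʳ (sym (ℙ-split v B))) ⟩
      ℙ B * fromℕ t ∎
      where
      open ≤-Reasoning
      B′ : Subset n → Event
      B′ S = B ∩ᵉ returned v S
      ∑′≤t : ∀ S ω → B′ S ∋ ω → sum (map (value ω) vs) ℕ.+ (v S ℕ.+ b) ℕ.≤ t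
      -- On `B′ S` the solution for `v` is `S`, so `value ω v` equals `v S` and moves from the sum
      -- to the accumulator.
      ∑′≤t S ω ∋B′ with ∋B , ∋S ← ∋-∩⁻ B (returned v S) ∋B′
        with ≡.refl ← Equivalence.to (occurs-returns k (fromℕ ∘ v) S ω) ∋S =
        ≡.subst (ℕ._≤ t) (rearrange (value ω v) _ b) (∑≤t ω ∋B)
        where
        rearrange : ∀ x y z → x ℕ.+ y ℕ.+ z ≡ y ℕ.+ (x ℕ.+ z)
        rearrange = solve-∀

    length*-≤-totalOn : ∀ {x B} vs → All (λ v → x ≤ expectedOn B v) vs →
                        x * fromℕ (length vs) ≤ totalOn B vs
    length*-≤-totalOn {x} [] [] = ≤-reflexive (zeroʳ x)
    length*-≤-totalOn {x} (v ∷ vs) (x≤ ∷ xs≤) = ≤-trans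
      (≤-reflexive (*-fromℕ-suc x (length vs))) (+-mono-≤ x≤ (length*-≤-totalOn vs xs≤))

    -- Averaging as in Yao's principle: all instances share the same `ω`, so a bound on the sum of
    -- the values for each `ω` passes to the sum of the expectations, each of which is at least `x`.
    average-≤ : ∀ {x t} vs → All (λ v → x ≤ expected A k (fromℕ ∘ v)) vs →
      (∀ ω → sum (map (value ω) vs) ℕ.≤ t) → x * fromℕ (length vs) ≤ fromℕ t
    average-≤ {x} {t} vs x≤ ∑≤t = begin
      x * fromℕ (length vs)
        ≤⟨ length*-≤-totalOn vs (All.map (λ {v} p → ≤-trans p (≤-reflexive (expectedOn-certain v))) x≤) ⟩
      totalOn certain vs                      ≈⟨ +-identityʳ _ ⟨
      totalOn certain vs + 0#                 ≈⟨ +-congˡ (zeroʳ (ℙ certain)) ⟨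
      totalOn certain vs + ℙ certain * fromℕ 0
        ≤⟨ totalOn-≤ vs 0 t certain (λ ω _ → ≡.subst (ℕ._≤ t) (≡.sym (ℕ.+-identityʳ _)) (∑≤t ω)) ⟩
      ℙ certain * fromℕ t                     ≈⟨ *-congʳ ℙ-certain ⟩
      1# * fromℕ t                            ≈⟨ *-identityˡ (fromℕ t) ⟩
      fromℕ t                                 ∎
      where open ≤-Reasoning

  -- The hard objective as an instance of the model.

  trapFunction : ∀ {m} → ℕ → Subset m → SetFunction (suc m)
  trapFunction k G = fromℕ ∘ trap k G

  trapFunction-nonNegative : ∀ {m} k (G : Subset m) → NonNegative (trapFunction k G)
  trapFunction-nonNegative k G S = 0≤fromℕ (trap k G S)

  trapFunction-submodular : ∀ {m} k (G : Subset m) → Submodular (trapFunction k G)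
  trapFunction-submodular k G S T = begin
    fromℕ (trap k G (S ∪ T)) + fromℕ (trap k G (S ∩ T)) ≈⟨ fromℕ-+ (trap k G (S ∪ T)) _ ⟨
    fromℕ (trap k G (S ∪ T) ℕ.+ trap k G (S ∩ T))       ≤⟨ fromℕ-mono-≤ (trap-submodular k G S T) ⟩
    fromℕ (trap k G S ℕ.+ trap k G T)                   ≈⟨ fromℕ-+ (trap k G S) _ ⟩
    fromℕ (trap k G S) + fromℕ (trap k G T)             ∎
    where open ≤-Reasoning

  trapFunction-monotone : ∀ {m} k (G : Subset m) → ∣ ∁ G ∣ ℕ.≤ k → Monotone (trapFunction k G)
  trapFunction-monotone k G ∣∁G∣≤k S T S⊆T = fromℕ-mono-≤ (trap-monotone k G ∣∁G∣≤k S T S⊆T)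

  trapFunction-optimum : ∀ {m} N (G : Subset m) → N ℕ.≤ ∣ G ∣ →
    ∃[ S ] (IsOptimal (suc N) (trapFunction (suc N) G) S ×
            trapFunction (suc N) G S ≡ fromℕ (optimum N))
  trapFunction-optimum N G N≤∣G∣ with S , ∣S∣≡k , trap≡ ← trap-optimum N G N≤∣G∣ =
    S , (ℕ.≤-reflexive ∣S∣≡k , λ T ∣T∣≤k →
          fromℕ-mono-≤ (≡.subst (trap (suc N) G T ℕ.≤_) (≡.sym trap≡) (trap≤optimum N G T ∣T∣≤k)))
      , ≡.cong fromℕ trap≡

  competitive-on-trap : ∀ {m α N} (perf : Performance) (G : Subset m) →
    Competitive α perf → N ℕ.≤ m → N ℕ.≤ ∣ G ∣ →
    α * fromℕ (optimum N) ≤ perf (suc N) (trapFunction (suc N) G)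
  competitive-on-trap {α = α} {N} perf G competitive N≤m N≤∣G∣
    with S , optimal , f≡ ← trapFunction-optimum N G N≤∣G∣ =
    ≡.subst (λ x → α * x ≤ perf (suc N) (trapFunction (suc N) G)) f≡
      (competitive (suc N) (trapFunction (suc N) G) (s≤s N≤m)
        (trapFunction-nonNegative (suc N) G) (trapFunction-submodular (suc N) G) S optimal)

  competitiveOnMonotone-on-trap : ∀ {m α N} (perf : Performance) (G : Subset m) →
    CompetitiveOnMonotone α perf → N ℕ.≤ m → N ℕ.≤ ∣ G ∣ → ∣ ∁ G ∣ ℕ.≤ suc N →
    α * fromℕ (optimum N) ≤ perf (suc N) (trapFunction (suc N) G)
  competitiveOnMonotone-on-trap {α = α} {N} perf G competitive N≤m N≤∣G∣ ∣∁G∣≤k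
    with S , optimal , f≡ ← trapFunction-optimum N G N≤∣G∣ =
    ≡.subst (λ x → α * x ≤ perf (suc N) (trapFunction (suc N) G)) f≡
      (competitive (suc N) (trapFunction (suc N) G) (s≤s N≤m)
        (trapFunction-nonNegative (suc N) G) (trapFunction-submodular (suc N) G)
        (trapFunction-monotone (suc N) G ∣∁G∣≤k) S optimal)

  -- `beforeLast (trapFunction k G)` computes to `fromℕ ∘ ∣_∣`, which does not mention `G`: the set
  -- held before the last element is the same for every hidden set.
  solution-trap : ∀ (D : DeterministicAlgorithm) k {m} (G : Subset m) →
    let open DeterministicAlgorithm D in
    trap k G (solution k (trapFunction k G)) ℕ.≤ k ℕ.+ ∣ solution k (fromℕ ∘ ∣_∣ {m}) ∩ G ∣
  solution-trap D k G =
    trap-after k G _ _ (online k (trapFunction k G)) (feasible k (trapFunction k G))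
    where open DeterministicAlgorithm D

  -- Each of the `q` instances contributes `k` plus the part of `held ω` in its block; by
  -- disjointness these parts total at most `∣ held ω ∣`, hence at most `k`.
  blocks-average : ∀ {a e x} (A : RandomizedAlgorithm a e) q k →
    All (λ G → x ≤ expected A k (trapFunction k G)) (blocks q k) →
    x * fromℕ q ≤ fromℕ (q ℕ.* k ℕ.+ k)
  blocks-average {x = x} A q k x≤ = ≡.subst (λ l → x * fromℕ l ≤ fromℕ (q ℕ.* k ℕ.+ k))
    (≡.trans (length-map (trap k) (blocks q k)) (length-blocks q k))
    (average-≤ A k (map (trap k) (blocks q k)) (All.map⁺ x≤) ∑≤)
    where
    open RandomizedAlgorithm A
    open ℕ.≤-Reasoning
    held : Ω → Subset (q ℕ.* k)
    held ω = solution ω k (fromℕ ∘ ∣_∣)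
    bound : ∀ ω Gs → sum (map (value A k ω) (map (trap k) Gs)) ℕ.≤
                     length Gs ℕ.* k ℕ.+ sum (map (λ G → ∣ held ω ∩ G ∣) Gs)
    bound ω []       = z≤n
    bound ω (G ∷ Gs) = ℕ.≤-trans (ℕ.+-mono-≤ (solution-trap (run ω) k G) (bound ω Gs))
      (ℕ.≤-reflexive (rearrange k _ _ _))
      where
      rearrange : ∀ w x y z → w ℕ.+ x ℕ.+ (y ℕ.+ z) ≡ w ℕ.+ y ℕ.+ (x ℕ.+ z)
      rearrange = solve-∀
    ∑≤ : ∀ ω → sum (map (value A k ω) (map (trap k) (blocks q k))) ℕ.≤ q ℕ.* k ℕ.+ k
    ∑≤ ω = begin
      sum (map (value A k ω) (map (trap k) (blocks q k)))
        ≤⟨ bound ω (blocks q k) ⟩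
      length (blocks q k) ℕ.* k ℕ.+ sum (map (λ G → ∣ held ω ∩ G ∣) (blocks q k))
        ≤⟨ ℕ.+-mono-≤ (ℕ.≤-reflexive (≡.cong (ℕ._* k) (length-blocks q k)))
                      (∑∣p∩block∣≤∣p∣ q k (held ω)) ⟩
      q ℕ.* k ℕ.+ ∣ held ω ∣
        ≤⟨ ℕ.+-monoʳ-≤ (q ℕ.* k) (DeterministicAlgorithm.feasible (run ω) k (fromℕ ∘ ∣_∣)) ⟩
      q ℕ.* k ℕ.+ k ∎

  -- The three hardness bounds.

  module _ {ε} N (0<ε : 0# < ε) (1<εN : 1# < ε * fromℕ N) where

    private
      k : ℕ
      k = suc N

    -- With k blocks of size k, the held set meets the hidden block in only one
    -- element on average.
    randomized-hardness : ∀ {a e} (A : RandomizedAlgorithm a e) →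
      ¬ Competitive (1 / 2 + ε) (expected A)
    randomized-hardness A competitive =
      -- `3 ℕ.* k ℕ.+ 1` is chosen so that `2 (k² + k)` falls short by exactly one. It is linear in
      -- `k` while `optimum N ℕ.* k` is quadratic, which lets it be paid for even after
      -- multiplication by `N`.
      ratio-exceeds 1 2 N 0<ε 1<εN (optimum N ℕ.* k) (k ℕ.* k ℕ.+ k) (3 ℕ.* k ℕ.+ 1)
        (ℕ.≤-reflexive (slack N)) (m+n≡o⇒m≤o (payment N))
        (≤-trans (≤-reflexive (*-fromℕ-assoc _ (optimum N) k))
          (blocks-average A k k (All.map hard (∣block∣≡k k k))))
      where
      hard : ∀ {G : Subset (k ℕ.* k)} → ∣ G ∣ ≡ k →
             (1 / 2 + ε) * fromℕ (optimum N) ≤ expected A k (trapFunction k G)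
      hard {G} ∣G∣≡k = competitive-on-trap (expected A) G competitive
        (ℕ.m≤n⇒m≤n+o (N ℕ.* k) (ℕ.n≤1+n N)) (≡.subst (N ℕ.≤_) (≡.sym ∣G∣≡k) (ℕ.n≤1+n N))
      slack : ∀ N → suc (2 ℕ.* (suc N ℕ.* suc N ℕ.+ suc N)) ≡
                    1 ℕ.* ((suc N ℕ.+ N) ℕ.* suc N) ℕ.+ (3 ℕ.* suc N ℕ.+ 1)
      slack = solve-∀
      payment : ∀ N → N ℕ.* (3 ℕ.* suc N ℕ.+ 1) ℕ.+ (N ℕ.* N ℕ.+ 2 ℕ.* N ℕ.+ 2) ≡
                      2 ℕ.* ((suc N ℕ.+ N) ℕ.* suc N)
      payment = solve-∀

    -- With only two blocks of size k, the trap is monotone.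
    randomized-monotone-hardness : ∀ {a e} (A : RandomizedAlgorithm a e) →
      ¬ CompetitiveOnMonotone (3 / 4 + ε) (expected A)
    randomized-monotone-hardness A competitive =
      -- The two instances total at most `3 k` against `2 (2 k - 1)` for the optima, and
      -- `4 * 3 k + 1 = 3 * 2 (2 k - 1) + 7`.
      ratio-exceeds 3 4 N 0<ε 1<εN (optimum N ℕ.* 2) (2 ℕ.* k ℕ.+ k) 7
        (ℕ.≤-reflexive (slack N)) (m+n≡o⇒m≤o (payment N))
        (≤-trans (≤-reflexive (*-fromℕ-assoc _ (optimum N) 2))
          (blocks-average A 2 k (All.map hard (∣block∣≡k 2 k))))
      where
      hard : ∀ {G : Subset (2 ℕ.* k)} → ∣ G ∣ ≡ k →
             (3 / 4 + ε) * fromℕ (optimum N) ≤ expected A k (trapFunction k G)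
      hard {G} ∣G∣≡k = competitiveOnMonotone-on-trap (expected A) G competitive
        (ℕ.m≤n⇒m≤n+o (1 ℕ.* k) (ℕ.n≤1+n N)) (≡.subst (N ℕ.≤_) (≡.sym ∣G∣≡k) (ℕ.n≤1+n N))
        -- The complement of one block has the size of the other, which is what monotonicity of the
        -- trap asks for.
        (ℕ.≤-reflexive (begin
          ∣ ∁ G ∣             ≡⟨ ∣∁p∣≡n∸∣p∣ G ⟩
          2 ℕ.* k ℕ.∸ ∣ G ∣   ≡⟨ ≡.cong (2 ℕ.* k ℕ.∸_) ∣G∣≡k ⟩
          2 ℕ.* k ℕ.∸ k       ≡⟨ ℕ.m+n∸m≡n k (1 ℕ.* k) ⟩
          1 ℕ.* k             ≡⟨ ℕ.*-identityˡ k ⟩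
          k                   ∎))
        where open ≡.≡-Reasoning
      slack : ∀ N → suc (4 ℕ.* (2 ℕ.* suc N ℕ.+ suc N)) ≡ 3 ℕ.* ((suc N ℕ.+ N) ℕ.* 2) ℕ.+ 7
      slack = solve-∀
      payment : ∀ N → N ℕ.* 7 ℕ.+ (9 ℕ.* N ℕ.+ 8) ≡ 4 ℕ.* ((suc N ℕ.+ N) ℕ.* 2)
      payment = solve-∀

    -- The held set of a deterministic algorithm is known in advance, so its
    -- complement can be made the hidden set.
    deterministic-monotone-hardness : ∀ (D : DeterministicAlgorithm) →
      ¬ CompetitiveOnMonotone (1 / 2 + ε) (achieved D)
    deterministic-monotone-hardness D competitive =
      -- A single instance: `k` against `2 k - 1`, and `2 k + 1 = (2 k - 1) + 2`.
      ratio-exceeds 1 2 N 0<ε 1<εN (optimum N) k 2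
        (ℕ.≤-reflexive (slack N)) (m+n≡o⇒m≤o (payment N))
        (≤-trans
          (competitiveOnMonotone-on-trap (achieved D) (∁ held) competitive
            (ℕ.m≤n⇒m≤n+o k (ℕ.n≤1+n N)) N≤∣∁held∣
            -- The set outside the hidden one is `held` itself, so monotonicity reduces to
            -- feasibility.
            (≡.subst (λ S → ∣ S ∣ ℕ.≤ k) (≡.sym (∁-involutive held)) ∣held∣≤k))
          (fromℕ-mono-≤ (ℕ.≤-trans (solution-trap D k (∁ held))
            (ℕ.≤-reflexive (≡.trans (≡.cong (k ℕ.+_) (∣p∩∁p∣≡0 held)) (ℕ.+-identityʳ k))))))
      where
      open DeterministicAlgorithm D using (solution; feasible)
      -- Twice `k` earlier elements leave at least `k` outside `held`, enough for the `N` that the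
      -- optimum takes.
      held : Subset (k ℕ.+ k)
      held = solution k (fromℕ ∘ ∣_∣)
      ∣held∣≤k : ∣ held ∣ ℕ.≤ k
      ∣held∣≤k = feasible k (fromℕ ∘ ∣_∣)
      N≤∣∁held∣ : N ℕ.≤ ∣ ∁ held ∣
      N≤∣∁held∣ = begin
        N                        ≤⟨ ℕ.n≤1+n N ⟩
        k                        ≡⟨ ℕ.m+n∸m≡n k k ⟨
        k ℕ.+ k ℕ.∸ k            ≤⟨ ℕ.∸-monoʳ-≤ (k ℕ.+ k) ∣held∣≤k ⟩
        k ℕ.+ k ℕ.∸ ∣ held ∣     ≡⟨ ∣∁p∣≡n∸∣p∣ held ⟨
        ∣ ∁ held ∣               ∎
        where open ℕ.≤-Reasoning
      slack : ∀ N → suc (2 ℕ.* suc N) ≡ 1 ℕ.* (suc N ℕ.+ N) ℕ.+ 2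
      slack = solve-∀
      payment : ∀ N → N ℕ.* 2 ℕ.+ (2 ℕ.* N ℕ.+ 2) ≡ 2 ℕ.* (suc N ℕ.+ N)
      payment = solve-∀

theorem1p6 : ∀ {c ℓ₁ ℓ₂ a e} (R : RealNumbers c ℓ₁ ℓ₂) →
    let open CardinalityModel R in
    ∀ (ε : ℝ) → 0# < ε →
    (∀ (A : RandomizedAlgorithm a e) → ¬ Competitive (1 / 2 + ε) (expected A))
    × (∀ (A : RandomizedAlgorithm a e) → ¬ CompetitiveOnMonotone (3 / 4 + ε) (expected A))
    × (∀ (D : DeterministicAlgorithm) → ¬ CompetitiveOnMonotone (1 / 2 + ε) (achieved D))
-- One `N` with `1# < ε * fromℕ N` serves all three bounds, each with `k = suc N`.
theorem1p6 R ε 0<ε with N , 1<εN ← OrderedField.1<multiple R ε 0<ε =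
    randomized-hardness R N 0<ε 1<εN
  , randomized-monotone-hardness R N 0<ε 1<εN
  , deterministic-monotone-hardness R N 0<ε 1<εN
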